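{- For all positive integers $s,k$ and every integer $n\geq 2$, the graph $sL_{n+1}\cup kL_n$ (the disjoint union of $s$ copies of $L_{n+1}$ and $k$ copies of $L_n$) is $C_4$-supermagic.
   Context: All graphs are finite and simple. For a graph $H$, a graph $G=(V,E)$ has an $H$-covering if every edge of $G$ belongs to a subgraph of $G$ isomorphic to $H$. For such $G$, an $H$-magic labeling is a bijection $\lambda: V\cup E\to\{1,2,\dots,|V|+|E|\}$ for which there is a constant $c$ such that for every subgraph $H'=(V',E')$ of $G$ isomorphic to $H$, $\sum_{v\in V'}\lambda(v)+\sum_{e\in E'}\lambda(e)=c$. It is $H$-supermagic if moreover $\{\lambda(v):v\in V\}=\{1,\dots,|V|\}$; $G$ is $H$-supermagic if it admits such a labeling. $C_k$ is the cycle of length $k$. $sG$ denotes the disjoint union of $s$ copies of $G$, and $\cup$ denotes disjoint union. The ladder $L_n=P_n\times P_2$ ($n\ge2$) has vertices $u_i,v_i$ ($1\le i\le n$) and edges $u_iv_i$ ($1\le i\le n$), $u_iu_{i+1}$ and $v_iv_{i+1}$ ($1\le i\le n-1$). -}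

module Defs where

open import Algebra.Properties.CommutativeMonoid.Sum using (sum)
open import Data.Bool.Base using (Bool; true; false; T)
open import Data.Bool.Properties using (T-irrelevant)
open import Data.Fin.Base using (Fin; zero; suc; toℕ; fromℕ; inject₁)
open import Data.Fin.Properties using (+↔⊎; *↔×; toℕ-inject₁; inject₁-injective)
open import Data.Nat.Base using (ℕ; zero; suc; pred; _+_; _*_; _≤_)
open import Data.Nat.Properties using (+-0-commutativeMonoid; 1+n≢n; m≢1+n+m; _≤?_)
open import Data.Product.Base using (Σ; Σ-syntax; ∃-syntax; _×_; _,_; proj₁; proj₂; swap; map)
open import Data.Product.Function.Dependent.Propositional using (Σ-↔)
open import Data.Product.Function.NonDependent.Propositional using (_×-↔_)
open import Data.Product.Properties using (,-injectiveˡ; ,-injectiveʳ)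
open import Data.Sum.Base using (_⊎_; inj₁; inj₂)
open import Data.Sum.Function.Propositional using (_⊎-↔_)
open import Data.Sum.Properties using (inj₁-injective; inj₂-injective)
open import Function.Base using (_∘_)
open import Function.Bundles using (_↔_; _⇔_; mk↔ₛ′; Inverse)
open import Function.Properties.Inverse using (↔-refl; ↔-sym; ↔-trans)
open import Relation.Binary.PropositionalEquality
  using (_≡_; _≢_; refl; sym; trans; cong; cong₂)
open import Relation.Nullary.Decidable using (True)
open import Relation.Nullary.Negation using (contradiction)

------------------------------------------------------------------------
-- Finite types

record Finite (A : Set) : Set where
  field
    card : ℕ
    enum : A ↔ Fin card

open Finite public

sumOver : ∀ {A} → Finite A → (A → ℕ) → ℕ
sumOver F f = sum +-0-commutativeMonoid (f ∘ Inverse.from (enum F))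

Fin-finite : ∀ n → Finite (Fin n)
Fin-finite n = record { card = n ; enum = ↔-refl }

⊎-finite : ∀ {A B} → Finite A → Finite B → Finite (A ⊎ B)
⊎-finite F G = record
  { card = card F + card G
  ; enum = ↔-trans (enum F ⊎-↔ enum G) (↔-sym +↔⊎)
  }

×-finite : ∀ {A B} → Finite A → Finite B → Finite (A × B)
×-finite F G = record
  { card = card F * card G
  ; enum = ↔-trans (enum F ×-↔ enum G) (↔-sym *↔×)
  }

T-finite : ∀ b → Finite (T b)
T-finite true  = record
  { card = 1
  ; enum = mk↔ₛ′ (λ _ → zero) _ (λ { zero → refl }) (λ _ → refl)
  }
T-finite false = record
  { card = 0
  ; enum = mk↔ₛ′ (λ ()) (λ ()) (λ ()) (λ ())
  }

Subset : (A : Set) → (A → Bool) → Set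
Subset A p = Σ[ x ∈ A ] T (p x)

subset-≡ : ∀ {A} {p : A → Bool} {x y : Subset A p} → proj₁ x ≡ proj₁ y → x ≡ y
subset-≡ {x = x , px} {y = .x , py} refl = cong (x ,_) (T-irrelevant px py)

subset-suc : ∀ {n} (p : Fin (suc n) → Bool) →
             Subset (Fin (suc n)) p ↔ (T (p zero) ⊎ Subset (Fin n) (p ∘ suc))
subset-suc p = mk↔ₛ′
  (λ { (zero , t) → inj₁ t ; (suc i , t) → inj₂ (i , t) })
  (λ { (inj₁ t) → zero , t ; (inj₂ (i , t)) → suc i , t })
  (λ { (inj₁ t) → refl ; (inj₂ _) → refl })
  (λ { (zero , t) → refl ; (suc i , t) → refl })

↔-finite : ∀ {A B} → A ↔ B → Finite B → Finite A
↔-finite A↔B F = record { card = card F ; enum = ↔-trans A↔B (enum F) }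

Fin-subset-finite : ∀ n (p : Fin n → Bool) → Finite (Subset (Fin n) p)
Fin-subset-finite zero    p = record
  { card = 0 ; enum = mk↔ₛ′ (λ ()) (λ ()) (λ ()) (λ ()) }
Fin-subset-finite (suc n) p = ↔-finite (subset-suc p)
  (⊎-finite (T-finite (p zero)) (Fin-subset-finite n (p ∘ suc)))

subset-finite : ∀ {A} → Finite A → (p : A → Bool) → Finite (Subset A p)
subset-finite F p = ↔-finite
  (↔-sym (Σ-↔ (↔-sym (enum F)) ↔-refl))
  (Fin-subset-finite (card F) (p ∘ Inverse.from (enum F)))

------------------------------------------------------------------------
-- Finite simple graphs

-- The order in which `ends e` lists the two endpoints of e carries no
-- meaning; everything below is invariant under swapping them.
record Graph : Set₁ where
  field
    V        : Set
    E        : Set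
    V-finite : Finite V
    E-finite : Finite E
    ends     : E → V × V
    noLoops    : ∀ e → proj₁ (ends e) ≢ proj₂ (ends e)
    noParallel : ∀ {e f} → ends e ≡ ends f ⊎ ends e ≡ swap (ends f) → e ≡ f

  ∣V∣ ∣E∣ : ℕ
  ∣V∣ = card V-finite
  ∣E∣ = card E-finite

  Adjacent : V → V → Set
  Adjacent x y = ∃[ e ] (ends e ≡ (x , y) ⊎ ends e ≡ (y , x))

open Graph

record _≅_ (G H : Graph) : Set where
  field
    bij      : V G ↔ V H
    adjacent : ∀ {x y} → Adjacent G x y ⇔ Adjacent H (Inverse.to bij x) (Inverse.to bij y)

infix 4 _≅_

-- Not necessarily induced.
record Subgraph (G : Graph) : Set where
  field
    inV    : V G → Bool
    inE    : E G → Bool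
    closed : ∀ {e} → T (inE e) → T (inV (proj₁ (ends G e))) × T (inV (proj₂ (ends G e)))

  toGraph : Graph
  toGraph = record
    { V          = Subset (V G) inV
    ; E          = Subset (E G) inE
    ; V-finite   = subset-finite (V-finite G) inV
    ; E-finite   = subset-finite (E-finite G) inE
    ; ends       = λ (e , e∈) → (proj₁ (ends G e) , proj₁ (closed e∈))
                              , (proj₂ (ends G e) , proj₂ (closed e∈))
    ; noLoops    = λ (e , _) eq → noLoops G e (cong proj₁ eq)
    ; noParallel = λ
      { (inj₁ eq) → subset-≡ (noParallel G (inj₁ (cong (map proj₁ proj₁) eq)))
      ; (inj₂ eq) → subset-≡ (noParallel G (inj₂ (cong (map proj₁ proj₁) eq)))
      }
    }

open Subgraph

------------------------------------------------------------------------
-- Coverings and magic labelings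

HasCovering : Graph → Graph → Set
HasCovering H G = ∀ (e : E G) → Σ[ S ∈ Subgraph G ] (T (inE S e) × toGraph S ≅ H)

-- Fin N stands for {1,…,N} through i ↦ 1 + toℕ i, see `label`.
Labeling : Graph → Set
Labeling G = (V G ⊎ E G) ↔ Fin (∣V∣ G + ∣E∣ G)

label : ∀ {G} → Labeling G → V G ⊎ E G → ℕ
label ℓ x = suc (toℕ (Inverse.to ℓ x))

weight : ∀ {G} → Labeling G → Subgraph G → ℕ
weight {G} ℓ S =
    sumOver (V-finite (toGraph S)) (λ (v , _) → label {G} ℓ (inj₁ v))
  + sumOver (E-finite (toGraph S)) (λ (e , _) → label {G} ℓ (inj₂ e))

IsMagic : (H G : Graph) → Labeling G → Set
IsMagic H G ℓ = ∃[ c ] (∀ (S : Subgraph G) → toGraph S ≅ H → weight {G} ℓ S ≡ c)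

VerticesFirst : (G : Graph) → Labeling G → Set
VerticesFirst G ℓ =
  ∀ j → (∃[ v ] label {G} ℓ (inj₁ v) ≡ j) ⇔ (1 ≤ j × j ≤ ∣V∣ G)

Supermagic : Graph → Graph → Set
Supermagic H G =
  HasCovering H G × (Σ[ ℓ ∈ Labeling G ] (IsMagic H G ℓ × VerticesFirst G ℓ))

------------------------------------------------------------------------
-- Disjoint unions

_∪_ : Graph → Graph → Graph
G ∪ H = record
  { V          = V G ⊎ V H
  ; E          = E G ⊎ E H
  ; V-finite   = ⊎-finite (V-finite G) (V-finite H)
  ; E-finite   = ⊎-finite (E-finite G) (E-finite H)
  ; ends       = ends′
  ; noLoops    = λ { (inj₁ e) eq → noLoops G e (inj₁-injective eq)
                   ; (inj₂ e) eq → noLoops H e (inj₂-injective eq) }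
  ; noParallel = λ {e} {f} → noParallel′ e f
  }
  where
  ends′ : E G ⊎ E H → (V G ⊎ V H) × (V G ⊎ V H)
  ends′ (inj₁ e) = map inj₁ inj₁ (ends G e)
  ends′ (inj₂ e) = map inj₂ inj₂ (ends H e)

  unmap : ∀ {A B : Set} {f : A → B} → (∀ {x y} → f x ≡ f y → x ≡ y) →
          ∀ {p q : A × A} → map f f p ≡ map f f q → p ≡ q
  unmap inj eq = cong₂ _,_ (inj (,-injectiveˡ eq)) (inj (,-injectiveʳ eq))

  noParallel′ : ∀ e f → ends′ e ≡ ends′ f ⊎ ends′ e ≡ swap (ends′ f) → e ≡ f
  noParallel′ (inj₁ e) (inj₁ f) (inj₁ eq) =
    cong inj₁ (noParallel G (inj₁ (unmap inj₁-injective eq)))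
  noParallel′ (inj₁ e) (inj₁ f) (inj₂ eq) =
    cong inj₁ (noParallel G (inj₂ (unmap inj₁-injective eq)))
  noParallel′ (inj₂ e) (inj₂ f) (inj₁ eq) =
    cong inj₂ (noParallel H (inj₁ (unmap inj₂-injective eq)))
  noParallel′ (inj₂ e) (inj₂ f) (inj₂ eq) =
    cong inj₂ (noParallel H (inj₂ (unmap inj₂-injective eq)))
  noParallel′ (inj₁ e) (inj₂ f) (inj₁ ())
  noParallel′ (inj₁ e) (inj₂ f) (inj₂ ())
  noParallel′ (inj₂ e) (inj₁ f) (inj₁ ())
  noParallel′ (inj₂ e) (inj₁ f) (inj₂ ())

_·_ : ℕ → Graph → Graph
s · G = record
  { V          = Fin s × V G
  ; E          = Fin s × E G
  ; V-finite   = ×-finite (Fin-finite s) (V-finite G)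
  ; E-finite   = ×-finite (Fin-finite s) (E-finite G)
  ; ends       = λ (i , e) → (i , proj₁ (ends G e)) , (i , proj₂ (ends G e))
  ; noLoops    = λ (_ , e) eq → noLoops G e (,-injectiveʳ eq)
  ; noParallel = λ
    { (inj₁ eq) → cong₂ _,_ (cong (proj₁ ∘ proj₁) eq)
                            (noParallel G (inj₁ (cong (map proj₂ proj₂) eq)))
    ; (inj₂ eq) → cong₂ _,_ (cong (proj₁ ∘ proj₁) eq)
                            (noParallel G (inj₂ (cong (map proj₂ proj₂) eq)))
    }
  }

infixr 6 _∪_
infixr 7 _·_

------------------------------------------------------------------------
-- Cycles

-- i ↦ i - 1 modulo n
prev : ∀ {n} → Fin n → Fin n
prev {suc n} zero    = fromℕ n
prev {suc n} (suc i) = inject₁ i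

inject₁≢suc : ∀ {n} {i : Fin n} → inject₁ i ≢ suc i
inject₁≢suc {i = i} eq = 1+n≢n (trans (sym (cong toℕ eq)) (toℕ-inject₁ i))

prev≢ : ∀ {m} (i : Fin (2 + m)) → prev i ≢ i
prev≢ zero    ()
prev≢ (suc i) = inject₁≢suc

prev²≢ : ∀ {m} (i : Fin (3 + m)) → prev (prev i) ≢ i
prev²≢ zero          ()
prev²≢ (suc zero)    ()
prev²≢ (suc (suc i)) eq = m≢1+n+m (toℕ i) {1}
  (trans (sym (trans (toℕ-inject₁ (inject₁ i)) (toℕ-inject₁ i))) (cong toℕ eq))

C : (k : ℕ) {3≤k : True (3 ≤? k)} → Graph
C k@(suc (suc (suc _))) = record
  { V          = Fin k
  ; E          = Fin k
  ; V-finite   = Fin-finite k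
  ; E-finite   = Fin-finite k
  ; ends       = λ i → prev i , i
  ; noLoops    = prev≢
  ; noParallel = λ
    { (inj₁ eq) → ,-injectiveʳ eq
    ; {i} (inj₂ eq) → contradiction
        (trans (cong prev (,-injectiveˡ eq)) (sym (,-injectiveʳ eq))) (prev²≢ i)
    }
  }

------------------------------------------------------------------------
-- Ladders

pattern u i = inj₁ i
pattern v i = inj₂ i

pattern rung  i = inj₁ i
pattern railᵤ i = inj₂ (inj₁ i)
pattern railᵥ i = inj₂ (inj₂ i)

-- For i < n - 1, these are i and i + 1 as elements of Fin n.
here next : ∀ {n} → Fin (pred n) → Fin n
here {suc n} i = inject₁ i
next {suc n} i = suc i

here≢next : ∀ {n} {i : Fin (pred n)} → here {n} i ≢ next i
here≢next {suc n} = inject₁≢suc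

here-injective : ∀ {n} {i j : Fin (pred n)} → here {n} i ≡ here j → i ≡ j
here-injective {suc n} = inject₁-injective

here-next-asym : ∀ {n} {i j : Fin (pred n)} → here {n} i ≡ next j → next {n} i ≢ here j
here-next-asym {suc n} {i} {j} p q = m≢1+n+m (toℕ i) {1}
  (trans (trans (sym (toℕ-inject₁ i)) (cong toℕ p))
         (cong suc (sym (trans (cong toℕ q) (toℕ-inject₁ j)))))

L : ℕ → Graph
L n = record
  { V          = Fin n ⊎ Fin n
  ; E          = Fin n ⊎ (Fin (pred n) ⊎ Fin (pred n))
  ; V-finite   = ⊎-finite (Fin-finite n) (Fin-finite n)
  ; E-finite   = ⊎-finite (Fin-finite n)
                   (⊎-finite (Fin-finite (pred n)) (Fin-finite (pred n)))
  ; ends       = ends′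
  ; noLoops    = noLoops′
  ; noParallel = λ {e} {f} → noParallel′ e f
  }
  where
  ends′ : Fin n ⊎ (Fin (pred n) ⊎ Fin (pred n)) → (Fin n ⊎ Fin n) × (Fin n ⊎ Fin n)
  ends′ (rung i)  = u i , v i
  ends′ (railᵤ i) = u (here i) , u (next i)
  ends′ (railᵥ i) = v (here i) , v (next i)

  noLoops′ : ∀ e → proj₁ (ends′ e) ≢ proj₂ (ends′ e)
  noLoops′ (rung i)  ()
  noLoops′ (railᵤ i) eq = here≢next (inj₁-injective eq)
  noLoops′ (railᵥ i) eq = here≢next (inj₂-injective eq)

  noParallel′ : ∀ e f → ends′ e ≡ ends′ f ⊎ ends′ e ≡ swap (ends′ f) → e ≡ f
  noParallel′ (rung i)  (rung j)  (inj₁ eq) = cong inj₁ (inj₁-injective (,-injectiveˡ eq))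
  noParallel′ (rung i)  (rung j)  (inj₂ ())
  noParallel′ (rung i)  (railᵤ j) (inj₁ ())
  noParallel′ (rung i)  (railᵤ j) (inj₂ ())
  noParallel′ (rung i)  (railᵥ j) (inj₁ ())
  noParallel′ (rung i)  (railᵥ j) (inj₂ ())
  noParallel′ (railᵤ i) (rung j)  (inj₁ ())
  noParallel′ (railᵤ i) (rung j)  (inj₂ ())
  noParallel′ (railᵤ i) (railᵤ j) (inj₁ eq) =
    cong (inj₂ ∘ inj₁) (here-injective (inj₁-injective (,-injectiveˡ eq)))
  noParallel′ (railᵤ i) (railᵤ j) (inj₂ eq) = contradiction
    (inj₁-injective (,-injectiveʳ eq)) (here-next-asym (inj₁-injective (,-injectiveˡ eq)))
  noParallel′ (railᵤ i) (railᵥ j) (inj₁ ())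
  noParallel′ (railᵤ i) (railᵥ j) (inj₂ ())
  noParallel′ (railᵥ i) (rung j)  (inj₁ ())
  noParallel′ (railᵥ i) (rung j)  (inj₂ ())
  noParallel′ (railᵥ i) (railᵤ j) (inj₁ ())
  noParallel′ (railᵥ i) (railᵤ j) (inj₂ ())
  noParallel′ (railᵥ i) (railᵥ j) (inj₁ eq) =
    cong (inj₂ ∘ inj₂) (here-injective (inj₂-injective (,-injectiveˡ eq)))
  noParallel′ (railᵥ i) (railᵥ j) (inj₂ eq) = contradiction
    (inj₂-injective (,-injectiveʳ eq)) (here-next-asym (inj₂-injective (,-injectiveˡ eq)))

{-# OPTIONS --safe #-}

-- Lay all N rungs of all the ladders in a row, numbered p = 0, 1, …, N - 1, and let z be the
-- zigzag 0, ⌈N/2⌉, 1, ⌈N/2⌉ + 1, …, for which z p + z (p + 1) = ⌈N/2⌉ + p whatever the parity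
-- of N. Up to constants, label the two vertices and the edge of rung p by N - 1 - p, z p and z p.
-- Two consecutive rungs then contribute -(2p + 1) + 2 (⌈N/2⌉ + p), which does not depend on p,
-- and numbering the rails of one side upwards and those of the other side downwards makes the
-- two rails of each square contribute a constant as well. The 4-cycles are exactly the squares:
-- two consecutive rails of a 4-cycle would go straight on, and the vertex halfway between their
-- ends is unique.

module Submission where

open import Defs
open import Algebra.Properties.CommutativeMonoid.Sum using (sum-permute; sum-cong-≗)
open import Data.Bool.Base using (Bool; true; false; T; not)
open import Data.Bool.Properties using (not-involutive)
open import Data.Fin.Base
  using (Fin; zero; suc; toℕ; inject₁; opposite; fromℕ<)
open import Data.Fin.Patterns using (0F; 1F; 2F; 3F)
open import Data.Fin.Permutation using (cast-id; reverse; ↔⇒≡)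
open import Data.Fin.Properties
  using ( +↔⊎; *↔×; any?; opposite-prop; toℕ-cast; toℕ-combine; toℕ-fromℕ<; toℕ-inject₁
        ; toℕ-injective; toℕ-↑ˡ; toℕ-↑ʳ; toℕ<n )
  renaming (_≟_ to _≟ᶠ_)
open import Data.Nat.Base using (ℕ; zero; suc; _+_; _*_; _≤_; s≤s; z≤n; ⌊_/2⌋; ⌈_/2⌉)
open import Data.Nat.Properties
  using ( +-0-commutativeMonoid; +-suc; m∸n+n≡m; suc-injective; 1+n≢n
        ; ≤-reflexive; ≤-trans; n≤1+n; 1+n≰n; m≢1+n+m; m≤n⇒m≤1+n )
open import Data.Nat.Tactic.RingSolver using (solve-∀)
open import Data.Product.Algebra using (×-distribˡ-⊎)
open import Data.Product.Base using (Σ-syntax; ∃-syntax; _×_; _,_; proj₁; proj₂; swap; map)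
open import Data.Product.Function.NonDependent.Propositional using (_×-↔_)
open import Data.Sum.Base as Sum using (_⊎_; inj₁; inj₂)
open import Data.Sum.Function.Propositional using (_⊎-↔_)
open import Function.Base using (_∘_)
open import Function.Bundles using (_↔_; _⇔_; mk↔ₛ′; mk⇔; Inverse; Equivalence)
open import Function.Properties.Inverse using (↔-refl; ↔-sym; ↔-trans)
open import Level using (0ℓ)
open import Relation.Binary.PropositionalEquality
open import Relation.Nullary.Decidable using (Dec; ⌊_⌋; toWitness; fromWitness; map′)
open import Relation.Nullary.Negation using (contradiction)

open Inverse using (to; from; strictlyInverseˡ; strictlyInverseʳ)
open Graph
open Subgraph
open _≅_

private
  variable
    A B : Set
    m n : ℕ

to-injective : (φ : A ↔ B) {x y : A} → to φ x ≡ to φ y → x ≡ y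
to-injective φ {x} {y} eq =
  trans (sym (strictlyInverseʳ φ x)) (trans (cong (from φ) eq) (strictlyInverseʳ φ y))

-- Finite types

-- The two enumerations and `φ` compose to a permutation of indices. This lets the weight of a
-- subgraph be computed in the cyclic order of an isomorphic cycle.
sumOver-↔ : (F : Finite A) (F′ : Finite B) (φ : A ↔ B) (f : A → ℕ) →
            sumOver F f ≡ sumOver F′ (f ∘ from φ)
sumOver-↔ F F′ φ f = trans
  (sum-permute +-0-commutativeMonoid (f ∘ from (enum F))
    (↔-trans (↔-sym (enum F′)) (↔-trans (↔-sym φ) (enum F))))
  (sum-cong-≗ +-0-commutativeMonoid
    (λ i → cong f (strictlyInverseʳ (enum F) (from φ (from (enum F′) i)))))

finite-≟ : Finite A → (x y : A) → Dec (x ≡ y)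
finite-≟ F x y = map′ (to-injective (enum F)) (cong (to (enum F))) (to (enum F) x ≟ᶠ to (enum F) y)

-- A `Labeling` takes its values in a `Fin` whose size is fixed by the graph, whereas the numberings
-- built below have sizes such as `⌈ n /2⌉ + ⌊ n /2⌋`. Types in bijection have the same size, so a
-- cast that keeps all values bridges the gap.
renumber : (F : Finite A) → A ↔ Fin n → A ↔ Fin (card F)
renumber F φ = ↔-trans φ (cast-id (sym (↔⇒≡ (↔-trans (↔-sym (enum F)) φ))))

toℕ-renumber : (F : Finite A) (φ : A ↔ Fin n) (x : A) →
               toℕ (to (renumber F φ) x) ≡ toℕ (to φ x)
toℕ-renumber F φ x = toℕ-cast _ (to φ x)

append : A ↔ Fin m → B ↔ Fin n → (A ⊎ B) ↔ Fin (m + n)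
append φ ψ = ↔-trans (φ ⊎-↔ ψ) (↔-sym +↔⊎)

toℕ-append₁ : (φ : A ↔ Fin m) (ψ : B ↔ Fin n) (x : A) →
              toℕ (to (append φ ψ) (inj₁ x)) ≡ toℕ (to φ x)
toℕ-append₁ φ ψ x = toℕ-↑ˡ (to φ x) _

toℕ-append₂ : (φ : A ↔ Fin m) (ψ : B ↔ Fin n) (y : B) →
              toℕ (to (append φ ψ) (inj₂ y)) ≡ m + toℕ (to ψ y)
toℕ-append₂ φ ψ y = toℕ-↑ʳ _ (to ψ y)

Bool×↔⊎ : (Bool × A) ↔ (A ⊎ A)
Bool×↔⊎ = mk↔ₛ′
  (λ { (false , x) → inj₁ x ; (true , x) → inj₂ x })
  (λ { (inj₁ x) → false , x ; (inj₂ x) → true , x })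
  (λ { (inj₁ x) → refl ; (inj₂ x) → refl })
  (λ { (false , x) → refl ; (true , x) → refl })

-- A sum in place of a truncated difference keeps the later computation within reach of the ring
-- solver.
toℕ-opposite : (i : Fin n) → toℕ (opposite i) + suc (toℕ i) ≡ n
toℕ-opposite i = trans (cong (_+ suc (toℕ i)) (opposite-prop i)) (m∸n+n≡m (toℕ<n i))

-- The zigzag permutation 0, ⌈n/2⌉, 1, ⌈n/2⌉ + 1, 2, …

-- With `inj₁ j` standing for 2j and `inj₂ j` for 2j + 1, this is the successor; `unhalf` below
-- decodes the representation.
flip : ℕ ⊎ ℕ → ℕ ⊎ ℕ
flip (inj₁ x) = inj₂ x
flip (inj₂ j) = inj₁ (suc j)

half : ℕ → ℕ ⊎ ℕ
half zero    = inj₁ 0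
half (suc p) = flip (half p)

-- Removing the first position swaps the roles of the halves: `⌊ suc n /2⌋` computes to `⌈ n /2⌉`
-- and `⌈ suc n /2⌉` to `suc ⌊ n /2⌋`.
halve : ∀ n → Fin n → Fin ⌈ n /2⌉ ⊎ Fin ⌊ n /2⌋
halve (suc n) zero    = inj₁ zero
halve (suc n) (suc i) with halve n i
... | inj₁ j = inj₂ j
... | inj₂ j = inj₁ (suc j)

unhalve : ∀ n → Fin ⌈ n /2⌉ ⊎ Fin ⌊ n /2⌋ → Fin n
unhalve zero    (inj₁ ())
unhalve zero    (inj₂ ())
unhalve (suc n) (inj₁ zero)    = zero
unhalve (suc n) (inj₁ (suc j)) = suc (unhalve n (inj₂ j))
unhalve (suc n) (inj₂ j)       = suc (unhalve n (inj₁ j))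

halve-unhalve : ∀ n x → halve n (unhalve n x) ≡ x
halve-unhalve zero    (inj₁ ())
halve-unhalve zero    (inj₂ ())
halve-unhalve (suc n) (inj₁ zero)    = refl
halve-unhalve (suc n) (inj₁ (suc j)) rewrite halve-unhalve n (inj₂ j) = refl
halve-unhalve (suc n) (inj₂ j)       rewrite halve-unhalve n (inj₁ j) = refl

unhalve-halve : ∀ n i → unhalve n (halve n i) ≡ i
unhalve-halve (suc n) zero    = refl
unhalve-halve (suc n) (suc i) with halve n i | unhalve-halve n i
... | inj₁ j | eq = cong suc eq
... | inj₂ j | eq = cong suc eq

-- The recursion of `halve` changes `n`, so its values at two neighbours in the same `Fin n` are
-- compared through `half`, which depends on the position alone.
toℕ-halve : ∀ n i → Sum.map toℕ toℕ (halve n i) ≡ half (toℕ i)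
toℕ-halve (suc n) zero    = refl
toℕ-halve (suc n) (suc i) rewrite sym (toℕ-halve n i) with halve n i
... | inj₁ j = refl
... | inj₂ j = refl

zigzag : Fin n ↔ Fin (⌈ n /2⌉ + ⌊ n /2⌋)
zigzag {n} = ↔-trans (mk↔ₛ′ (halve n) (unhalve n) (halve-unhalve n) (unhalve-halve n)) (↔-sym +↔⊎)

offset : ℕ → ℕ ⊎ ℕ → ℕ
offset h (inj₁ j) = j
offset h (inj₂ j) = h + j

toℕ-zigzag : (i : Fin n) → toℕ (to zigzag i) ≡ offset ⌈ n /2⌉ (half (toℕ i))
toℕ-zigzag {n} i rewrite sym (toℕ-halve n i) with halve n i
... | inj₁ j = toℕ-↑ˡ j ⌊ n /2⌋
... | inj₂ j = toℕ-↑ʳ ⌈ n /2⌉ j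

unhalf : ℕ ⊎ ℕ → ℕ
unhalf (inj₁ j) = j + j
unhalf (inj₂ j) = suc (j + j)

unhalf-half : ∀ p → unhalf (half p) ≡ p
unhalf-half zero = refl
unhalf-half (suc p) with half p | unhalf-half p
... | inj₁ j | eq = cong suc eq
... | inj₂ j | eq = cong suc (trans (+-suc j j) eq)

-- Neighbouring positions lie in different halves, so `h` is counted exactly once. The indices
-- within the halves are j and j for p = 2j, and j and j + 1 for p = 2j + 1; in both cases they add
-- up to `p`.
offset-half-suc : ∀ h p → offset h (half p) + offset h (half (suc p)) ≡ h + p
offset-half-suc h p with half p | unhalf-half p
... | inj₁ j | eq = trans (lemma h j) (cong (h +_) eq)
  where
  lemma : ∀ h j → j + (h + j) ≡ h + (j + j)
  lemma = solve-∀
... | inj₂ j | eq = trans (lemma h j) (cong (h +_) eq)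
  where
  lemma : ∀ h j → h + j + suc j ≡ h + suc (j + j)
  lemma = solve-∀

zigzag-suc : (i j : Fin n) → toℕ j ≡ suc (toℕ i) →
             toℕ (to zigzag i) + toℕ (to zigzag j) ≡ ⌈ n /2⌉ + toℕ i
zigzag-suc {n} i j eq rewrite toℕ-zigzag i | toℕ-zigzag j | eq = offset-half-suc ⌈ n /2⌉ (toℕ i)

-- Incidence and isomorphisms

Joins : (G : Graph) → E G → V G → V G → Set
Joins G e x y = ends G e ≡ (x , y) ⊎ ends G e ≡ (y , x)

Joins-unique : ∀ G {e f x y} → Joins G e x y → Joins G f x y → e ≡ f
Joins-unique G (inj₁ p) (inj₁ q) = noParallel G (inj₁ (trans p (sym q)))
Joins-unique G (inj₁ p) (inj₂ q) = noParallel G (inj₂ (trans p (sym (cong swap q))))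
Joins-unique G (inj₂ p) (inj₁ q) = noParallel G (inj₂ (trans p (sym (cong swap q))))
Joins-unique G (inj₂ p) (inj₂ q) = noParallel G (inj₁ (trans p (sym q)))

Joins-toGraph⁻ : ∀ {G} (S : Subgraph G) {e x y} →
                 Joins (toGraph S) e x y → Joins G (proj₁ e) (proj₁ x) (proj₁ y)
Joins-toGraph⁻ S = Sum.map (cong (map proj₁ proj₁)) (cong (map proj₁ proj₁))

module _ {G H : Graph} (iso : G ≅ H) where

  private
    image : ∀ e → Adjacent H (to (bij iso) (proj₁ (ends G e))) (to (bij iso) (proj₂ (ends G e)))
    image e = Equivalence.to (adjacent iso) (e , inj₁ refl)

    preimage : ∀ f → Adjacent G (from (bij iso) (proj₁ (ends H f)))
                                (from (bij iso) (proj₂ (ends H f)))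
    preimage f = Equivalence.from (adjacent iso)
      (f , inj₁ (cong₂ _,_ (sym (strictlyInverseˡ (bij iso) _)) (sym (strictlyInverseˡ (bij iso) _))))

    image-joins : ∀ {e x y} → Joins G e x y →
                  Joins H (proj₁ (image e)) (to (bij iso) x) (to (bij iso) y)
    image-joins {e} (inj₁ refl) = proj₂ (image e)
    image-joins {e} (inj₂ refl) = Sum.swap (proj₂ (image e))

  -- An isomorphism is given on vertices only. Adjacency provides an edge between the images of the
  -- ends of an edge, and the absence of parallel edges makes the two passages inverse to each
  -- other.
  ≅-edges : E G ↔ E H
  ≅-edges = mk↔ₛ′ (proj₁ ∘ image) (proj₁ ∘ preimage)
    (λ f → Joins-unique H
      (subst₂ (Joins H _) (strictlyInverseˡ (bij iso) _) (strictlyInverseˡ (bij iso) _)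
        (image-joins (proj₂ (preimage f))))
      (inj₁ refl))
    (λ e → Joins-unique G (preimage-image-joins e) (inj₁ refl))
    where
    preimage-image-joins : ∀ e → Joins G (proj₁ (preimage (proj₁ (image e))))
                                         (proj₁ (ends G e)) (proj₂ (ends G e))
    preimage-image-joins e with image e
    ... | f , inj₁ eq = subst₂ (Joins G _)
            (trans (cong (from (bij iso) ∘ proj₁) eq) (strictlyInverseʳ (bij iso) _))
            (trans (cong (from (bij iso) ∘ proj₂) eq) (strictlyInverseʳ (bij iso) _))
            (proj₂ (preimage f))
    ... | f , inj₂ eq = Sum.swap (subst₂ (Joins G _)
            (trans (cong (from (bij iso) ∘ proj₁) eq) (strictlyInverseʳ (bij iso) _))
            (trans (cong (from (bij iso) ∘ proj₂) eq) (strictlyInverseʳ (bij iso) _))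
            (proj₂ (preimage f)))

  ≅-edges-joins : ∀ f → Joins G (from ≅-edges f) (from (bij iso) (proj₁ (ends H f)))
                                                 (from (bij iso) (proj₂ (ends H f)))
  ≅-edges-joins f = proj₂ (preimage f)

-- Images of injective maps

-- Subgraphs are cut out by Boolean predicates, so membership in an image is decided by a search
-- through the enumeration of the domain.
inImage : Finite A → Finite B → (B → A) → A → Bool
inImage F F′ f x = ⌊ any? (λ i → finite-≟ F (f (from (enum F′) i)) x) ⌋

module _ (F : Finite A) (F′ : Finite B) (f : B → A) where

  inImage⁺ : ∀ {x} y → f y ≡ x → T (inImage F F′ f x)
  inImage⁺ {x} y eq = fromWitness {a? = any? (λ i → finite-≟ F (f (from (enum F′) i)) x)}
    (to (enum F′) y , trans (cong f (strictlyInverseʳ (enum F′) y)) eq)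

  inImage⁻ : ∀ {x} → T (inImage F F′ f x) → ∃[ y ] f y ≡ x
  inImage⁻ {x} t with toWitness {a? = any? (λ i → finite-≟ F (f (from (enum F′) i)) x)} t
  ... | i , eq = from (enum F′) i , eq

  image-↔ : (∀ {x y} → f x ≡ f y → x ≡ y) → Subset A (inImage F F′ f) ↔ B
  image-↔ inj = mk↔ₛ′ (λ (x , t) → proj₁ (inImage⁻ t)) (λ y → f y , inImage⁺ y refl)
    (λ y → inj (proj₂ (inImage⁻ {f y} (inImage⁺ y refl))))
    (λ (x , t) → subset-≡ (proj₂ (inImage⁻ t)))

record Embedding (H G : Graph) : Set where
  field
    onV       : V H → V G
    onE       : E H → E G
    injective : ∀ {x y} → onV x ≡ onV y → x ≡ y
    joins     : ∀ f → Joins G (onE f) (onV (proj₁ (ends H f))) (onV (proj₂ (ends H f)))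

module _ {H G : Graph} (φ : Embedding H G) where
  open Embedding φ

  private
    joins⁺ : ∀ {f x y} → Joins H f x y → Joins G (onE f) (onV x) (onV y)
    joins⁺ {f} (inj₁ refl) = joins f
    joins⁺ {f} (inj₂ refl) = Sum.swap (joins f)

    unpair : ∀ {x y : V H × V H} → map onV onV x ≡ map onV onV y → x ≡ y
    unpair eq = cong₂ _,_ (injective (cong proj₁ eq)) (injective (cong proj₂ eq))

    -- An edge of `G` has only one unordered pair of ends, and the injective `onV` can be cancelled
    -- from it.
    joins⁻ : ∀ {f x y} → Joins G (onE f) (onV x) (onV y) → Joins H f x y
    joins⁻ {f} j with joins f | j
    ... | inj₁ p | inj₁ q = inj₁ (unpair (trans (sym p) q))
    ... | inj₁ p | inj₂ q = inj₂ (unpair (trans (sym p) q))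
    ... | inj₂ p | inj₁ q = inj₂ (unpair (cong swap (trans (sym p) q)))
    ... | inj₂ p | inj₂ q = inj₁ (unpair (cong swap (trans (sym p) q)))

    inVᵢ : V G → Bool
    inVᵢ = inImage (V-finite G) (V-finite H) onV

    inEᵢ : E G → Bool
    inEᵢ = inImage (E-finite G) (E-finite H) onE

    endsInImage : ∀ {e} → T (inEᵢ e) → T (inVᵢ (proj₁ (ends G e))) × T (inVᵢ (proj₂ (ends G e)))
    endsInImage t with inImage⁻ (E-finite G) (E-finite H) onE t
    ... | f , refl with joins f
    ... | inj₁ eq = inImage⁺ (V-finite G) (V-finite H) onV _ (sym (cong proj₁ eq))
                  , inImage⁺ (V-finite G) (V-finite H) onV _ (sym (cong proj₂ eq))
    ... | inj₂ eq = inImage⁺ (V-finite G) (V-finite H) onV _ (sym (cong proj₁ eq))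
                  , inImage⁺ (V-finite G) (V-finite H) onV _ (sym (cong proj₂ eq))

  imageSubgraph : Subgraph G
  imageSubgraph = record { inV = inVᵢ ; inE = inEᵢ ; closed = endsInImage }

  onE∈image : ∀ f → T (inE imageSubgraph (onE f))
  onE∈image f = inImage⁺ (E-finite G) (E-finite H) onE f refl

  image≅ : toGraph imageSubgraph ≅ H
  image≅ = record
    { bij      = vs
    ; adjacent = λ {x} {y} → mk⇔ (fwd x y) (bwd x y)
    }
    where
    vs : V (toGraph imageSubgraph) ↔ V H
    vs = image-↔ (V-finite G) (V-finite H) onV injective

    onV-vs : ∀ x → onV (to vs x) ≡ proj₁ x
    onV-vs x = proj₂ (inImage⁻ (V-finite G) (V-finite H) onV (proj₂ x))

    fwd : ∀ x y → Adjacent (toGraph imageSubgraph) x y → Adjacent H (to vs x) (to vs y)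
    fwd x y ((e , t) , j)
      with inImage⁻ (E-finite G) (E-finite H) onE t | Joins-toGraph⁻ imageSubgraph {e , t} {x} {y} j
    ... | f , refl | j′ = f , joins⁻ (subst₂ (Joins G (onE f)) (sym (onV-vs x)) (sym (onV-vs y)) j′)

    bwd : ∀ x y → Adjacent H (to vs x) (to vs y) → Adjacent (toGraph imageSubgraph) x y
    bwd x y (f , j) = (onE f , onE∈image f) ,
      lift (subst₂ (Joins G (onE f)) (onV-vs x) (onV-vs y) (joins⁺ j))
      where
      lift : Joins G (onE f) (proj₁ x) (proj₁ y) →
             Joins (toGraph imageSubgraph) (onE f , onE∈image f) x y
      lift (inj₁ eq) = inj₁ (cong₂ _,_ (subset-≡ (cong proj₁ eq)) (subset-≡ (cong proj₂ eq)))
      lift (inj₂ eq) = inj₂ (cong₂ _,_ (subset-≡ (cong proj₁ eq)) (subset-≡ (cong proj₂ eq)))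

-- Labelings numbering the vertices before the edges

module _ (G : Graph) (ν : V G ↔ Fin m) (ε : E G ↔ Fin n) where

  verticesThenEdges : Labeling G
  verticesThenEdges = append (renumber (V-finite G) ν) (renumber (E-finite G) ε)

  label-vertex : ∀ x → label {G} verticesThenEdges (inj₁ x) ≡ suc (toℕ (to ν x))
  label-vertex x = cong suc (trans
    (toℕ-append₁ (renumber (V-finite G) ν) (renumber (E-finite G) ε) x)
    (toℕ-renumber (V-finite G) ν x))

  label-edge : ∀ e → label {G} verticesThenEdges (inj₂ e) ≡ suc (∣V∣ G + toℕ (to ε e))
  label-edge e = cong suc (trans
    (toℕ-append₂ (renumber (V-finite G) ν) (renumber (E-finite G) ε) e)
    (cong (∣V∣ G +_) (toℕ-renumber (E-finite G) ε e)))

  verticesFirst : VerticesFirst G verticesThenEdges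
  verticesFirst j = mk⇔ fwd bwd
    where
    ν′ : V G ↔ Fin (∣V∣ G)
    ν′ = renumber (V-finite G) ν

    label≡ : ∀ x → label {G} verticesThenEdges (inj₁ x) ≡ suc (toℕ (to ν′ x))
    label≡ x = cong suc (toℕ-append₁ ν′ (renumber (E-finite G) ε) x)

    fwd : (∃[ x ] label {G} verticesThenEdges (inj₁ x) ≡ j) → 1 ≤ j × j ≤ ∣V∣ G
    fwd (x , refl) = s≤s z≤n , subst (_≤ ∣V∣ G) (sym (label≡ x)) (toℕ<n (to ν′ x))

    bwd : 1 ≤ j × j ≤ ∣V∣ G → ∃[ x ] label {G} verticesThenEdges (inj₁ x) ≡ j
    bwd (s≤s z≤n , j≤) = from ν′ (fromℕ< j≤) , trans (label≡ _)
      (cong suc (trans (cong toℕ (strictlyInverseˡ ν′ (fromℕ< j≤))) (toℕ-fromℕ< j≤)))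

-- Ladders laid end to end

-- Rungs are numbered along the ladders, one ladder after the other; a square is
-- the part of a ladder between two consecutive rungs.
record LadderUnion (G : Graph) : Set₁ where
  field
    {Rung Square} : Set
    {#rungs #squares} : ℕ
    rungs       : Rung ↔ Fin #rungs
    squares     : Square ↔ Fin #squares
    left right  : Square → Rung
    consecutive : ∀ q → toℕ (to rungs (right q)) ≡ suc (toℕ (to rungs (left q)))
    covered     : ∀ r → ∃[ q ] (left q ≡ r ⊎ right q ≡ r)
    -- The Boolean names a side of the ladder: rungs change it, rails keep it.
    vertices    : V G ↔ (Bool × Rung)
    edges       : E G ↔ (Rung ⊎ (Bool × Square))
    ends-rung   : ∀ r → ends G (from edges (inj₁ r)) ≡
                        (from vertices (false , r) , from vertices (true , r))
    ends-rail   : ∀ b q → ends G (from edges (inj₂ (b , q))) ≡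
                          (from vertices (b , left q) , from vertices (b , right q))

  level : Rung → ℕ
  level r = toℕ (to rungs r)

  level-injective : ∀ {r r′} → level r ≡ level r′ → r ≡ r′
  level-injective eq = to-injective rungs (toℕ-injective eq)

  right-cong : ∀ {q q′} → left q ≡ left q′ → right q ≡ right q′
  right-cong eq = level-injective
    (trans (consecutive _) (trans (cong (suc ∘ level) eq) (sym (consecutive _))))

  -- Squares with the same left rung also have the same right rung, so their rails on side `false`
  -- would be parallel edges if they were different.
  left-injective : ∀ {q q′} → left q ≡ left q′ → q ≡ q′
  left-injective {q} {q′} eq = same-square
    (to-injective (↔-sym edges) (Joins-unique G (inj₁ (ends-rail false q))
      (inj₁ (trans (ends-rail false q′)
      (cong₂ _,_ (cong (from vertices ∘ (false ,_)) (sym eq))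
                 (cong (from vertices ∘ (false ,_)) (sym (right-cong eq))))))))
    where
    same-square : ∀ {q q′} → inj₂ {A = Rung} (false , q) ≡ inj₂ (false , q′) → q ≡ q′
    same-square refl = refl

  left≢right : ∀ q → left q ≢ right q
  left≢right q eq = 1+n≢n (trans (sym (consecutive q)) (cong level (sym eq)))

-- With at least two rungs there is a first square, which covers rung 0; each rung `suc r` is the
-- right rung of square `r`.
ladder : ∀ {n} → 2 ≤ n → LadderUnion (L n)
ladder {suc zero}    (s≤s ())
ladder {suc (suc n)} _ = record
  { rungs       = ↔-refl
  ; squares     = ↔-refl
  ; left        = inject₁
  ; right       = suc
  ; consecutive = λ q → cong suc (sym (toℕ-inject₁ q))
  ; covered     = λ { zero → zero , inj₁ refl ; (suc r) → r , inj₂ refl }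
  ; vertices    = ↔-sym Bool×↔⊎
  ; edges       = ↔-refl ⊎-↔ ↔-sym Bool×↔⊎
  ; ends-rung   = λ _ → refl
  ; ends-rail   = λ { false _ → refl ; true _ → refl }
  }

×-shuffle : {A B C : Set} → (A × (B × C)) ↔ (B × (A × C))
×-shuffle = mk↔ₛ′ (λ (a , b , c) → b , a , c) (λ (b , a , c) → a , b , c) (λ _ → refl) (λ _ → refl)

⊎-shuffle : {A B C D : Set} → ((A ⊎ B) ⊎ (C ⊎ D)) ↔ ((A ⊎ C) ⊎ (B ⊎ D))
⊎-shuffle = mk↔ₛ′ shuffle shuffle involutive involutive
  where
  shuffle : {A B C D : Set} → (A ⊎ B) ⊎ (C ⊎ D) → (A ⊎ C) ⊎ (B ⊎ D)
  shuffle (inj₁ (inj₁ x)) = inj₁ (inj₁ x)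
  shuffle (inj₁ (inj₂ x)) = inj₂ (inj₁ x)
  shuffle (inj₂ (inj₁ x)) = inj₁ (inj₂ x)
  shuffle (inj₂ (inj₂ x)) = inj₂ (inj₂ x)

  involutive : {A B C D : Set} (x : (A ⊎ B) ⊎ (C ⊎ D)) → shuffle (shuffle x) ≡ x
  involutive (inj₁ (inj₁ x)) = refl
  involutive (inj₁ (inj₂ x)) = refl
  involutive (inj₂ (inj₁ x)) = refl
  involutive (inj₂ (inj₂ x)) = refl

-- Copy `i` occupies the block of levels starting at `#rungs * toℕ i`, so the two rungs of a square
-- are shifted by the same amount.
copies : ∀ {G} s → LadderUnion G → LadderUnion (s · G)
copies s P = record
  { rungs       = ↔-trans (↔-refl ×-↔ rungs) (↔-sym *↔×)
  ; squares     = ↔-trans (↔-refl ×-↔ squares) (↔-sym *↔×)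
  ; left        = λ (i , q) → i , left q
  ; right       = λ (i , q) → i , right q
  ; consecutive = λ (i , q) → trans (toℕ-combine i (to rungs (right q)))
      (trans (cong (#rungs * toℕ i +_) (consecutive q)) (trans (+-suc (#rungs * toℕ i) _)
        (cong suc (sym (toℕ-combine i (to rungs (left q)))))))
  ; covered     = λ (i , r) → (i , proj₁ (covered r)) ,
                              Sum.map (cong (i ,_)) (cong (i ,_)) (proj₂ (covered r))
  ; vertices    = ↔-trans (↔-refl ×-↔ vertices) ×-shuffle
  ; edges       = ↔-trans (↔-refl ×-↔ edges)
                    (↔-trans (×-distribˡ-⊎ 0ℓ _ _ _) (↔-refl ⊎-↔ ×-shuffle))
  ; ends-rung   = λ (i , r) → cong (λ (x , y) → (i , x) , (i , y)) (ends-rung r)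
  ; ends-rail   = λ b (i , q) → cong (λ (x , y) → (i , x) , (i , y)) (ends-rail b q)
  }
  where open LadderUnion P

union : ∀ {G H} → LadderUnion G → LadderUnion H → LadderUnion (G ∪ H)
union P P′ = record
  { rungs       = append P.rungs P′.rungs
  ; squares     = append P.squares P′.squares
  ; left        = Sum.map P.left P′.left
  ; right       = Sum.map P.right P′.right
  ; consecutive = λ
    { (inj₁ q) → trans (toℕ-append₁ P.rungs P′.rungs (P.right q))
        (trans (P.consecutive q) (cong suc (sym (toℕ-append₁ P.rungs P′.rungs (P.left q)))))
    ; (inj₂ q) → trans (toℕ-append₂ P.rungs P′.rungs (P′.right q))
        (trans (cong (P.#rungs +_) (P′.consecutive q)) (trans (+-suc _ _)
          (cong suc (sym (toℕ-append₂ P.rungs P′.rungs (P′.left q)))))) }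
  ; covered     = λ
    { (inj₁ r) → inj₁ (proj₁ (P.covered r)) ,
                 Sum.map (cong inj₁) (cong inj₁) (proj₂ (P.covered r))
    ; (inj₂ r) → inj₂ (proj₁ (P′.covered r)) ,
                 Sum.map (cong inj₂) (cong inj₂) (proj₂ (P′.covered r)) }
  ; vertices    = ↔-trans (P.vertices ⊎-↔ P′.vertices) (↔-sym (×-distribˡ-⊎ 0ℓ _ _ _))
  ; edges       = ↔-trans (P.edges ⊎-↔ P′.edges)
                    (↔-trans ⊎-shuffle (↔-refl ⊎-↔ ↔-sym (×-distribˡ-⊎ 0ℓ _ _ _)))
  ; ends-rung   = λ
    { (inj₁ r) → cong (map inj₁ inj₁) (P.ends-rung r)
    ; (inj₂ r) → cong (map inj₂ inj₂) (P′.ends-rung r) }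
  ; ends-rail   = λ
    { b (inj₁ q) → cong (map inj₁ inj₁) (P.ends-rail b q)
    ; b (inj₂ q) → cong (map inj₂ inj₂) (P′.ends-rail b q) }
  }
  where
  module P = LadderUnion P
  module P′ = LadderUnion P′

-- The 4-cycles of a union of ladders

module _ {G : Graph} (P : LadderUnion G) where
  open LadderUnion P

  private
    Node Link : Set
    Node = Bool × Rung
    Link = Rung ⊎ (Bool × Square)

    -- Traversals of an edge in coordinates, with their direction visible. The ends are tied to
    -- `left`, `right` and `not` by equations, because these functions as indices would block
    -- pattern matching.
    data Step : Node → Link → Node → Set where
      across : ∀ {b b′ r} → b′ ≡ not b → Step (b , r) (inj₁ r) (b′ , r)
      up     : ∀ {b q r r′} → left q ≡ r → right q ≡ r′ → Step (b , r) (inj₂ (b , q)) (b , r′)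
      down   : ∀ {b q r r′} → right q ≡ r → left q ≡ r′ → Step (b , r) (inj₂ (b , q)) (b , r′)

    reverseStep : ∀ {x e y} → Step x e y → Step y e x
    reverseStep (across {b} refl) = across (sym (not-involutive b))
    reverseStep (up p p′)         = down p′ p
    reverseStep (down p p′)       = up p′ p

    Joins⇒Step : ∀ {e x y} → Joins G e x y → Step (to vertices x) (to edges e) (to vertices y)
    Joins⇒Step {e} {x} {y} j = link (to edges e)
      (subst (λ e → Joins G e x y) (sym (strictlyInverseʳ edges e)) j)
      where
      nodes : ∀ {z w} → from vertices z ≡ w → z ≡ to vertices w
      nodes refl = sym (strictlyInverseˡ vertices _)

      ordered : ∀ l {x y} → ends G (from edges l) ≡ (x , y) → Step (to vertices x) l (to vertices y)
      ordered (inj₁ r) eq = subst₂ (λ x y → Step x (inj₁ r) y)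
        (nodes (cong proj₁ (trans (sym (ends-rung r)) eq)))
        (nodes (cong proj₂ (trans (sym (ends-rung r)) eq)))
        (across refl)
      ordered (inj₂ (b , q)) eq = subst₂ (λ x y → Step x (inj₂ (b , q)) y)
        (nodes (cong proj₁ (trans (sym (ends-rail b q)) eq)))
        (nodes (cong proj₂ (trans (sym (ends-rail b q)) eq)))
        (up refl refl)

      link : ∀ l {x y} → Joins G (from edges l) x y → Step (to vertices x) l (to vertices y)
      link l (inj₁ eq) = ordered l eq
      link l (inj₂ eq) = reverseStep (ordered l eq)

    height : Node → ℕ
    height (b , r) = level r

    up-height : ∀ {q r r′} → left q ≡ r → right q ≡ r′ → level r′ ≡ suc (level r)
    up-height refl refl = consecutive _

    height-bound : ∀ {x e y} → Step x e y → height y ≤ suc (height x)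
    height-bound (across _)  = n≤1+n _
    height-bound (up p p′)   = ≤-reflexive (up-height p p′)
    height-bound (down p p′) = ≤-trans (n≤1+n _) (≤-trans (≤-reflexive (sym (up-height p′ p))) (n≤1+n _))

    -- A step gains at most one level. To gain two levels in two steps, the first must go up, and
    -- going up stays on the same side.
    middle : ∀ {x e y f z} → Step x e y → Step y f z → height z ≡ 2 + height x →
             proj₁ y ≡ proj₁ x × height y ≡ suc (height x)
    middle (across _)  t eq = contradiction (≤-trans (≤-reflexive (sym eq)) (height-bound t)) 1+n≰n
    middle (up p p′)   t eq = refl , up-height p p′
    middle (down p p′) t eq = contradiction
      (≤-trans (≤-reflexive (sym eq)) (≤-trans (height-bound t)
        (≤-trans (≤-reflexive (sym (up-height p′ p))) (n≤1+n _))))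
      1+n≰n

    middle-unique : ∀ {x e y f z g y′ h} → Step x e y → Step y f z → Step x g y′ → Step y′ h z →
                    height z ≡ 2 + height x → y ≡ y′
    middle-unique s t s′ t′ eq with middle s t eq | middle s′ t′ eq
    ... | p , p′ | q , q′ = cong₂ _,_ (trans p (sym q)) (level-injective (trans p′ (sym q′)))

    -- Two rails in the same direction would put both `x₁` and `x₃` halfway between `x₀` and `x₂`.
    -- Two rails in opposite directions would lead back to `x₀`, because either rung of a square
    -- determines the other.
    no-straight : ∀ {x₀ x₁ x₂ x₃ b₁ b₂ e₃ e₀} → x₀ ≢ x₂ → x₁ ≢ x₃ →
      Step x₀ (inj₂ b₁) x₁ → Step x₁ (inj₂ b₂) x₂ → Step x₂ e₃ x₃ → Step x₃ e₀ x₀ → {A : Set} → A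
    no-straight x₀≢x₂ x₁≢x₃ s@(up p p′) t@(up q q′) s′ t′ = contradiction
      (middle-unique s t (reverseStep t′) (reverseStep s′)
        (trans (up-height q q′) (cong suc (up-height p p′)))) x₁≢x₃
    no-straight x₀≢x₂ x₁≢x₃ s@(down p p′) t@(down q q′) s′ t′ = contradiction
      (middle-unique (reverseStep t) (reverseStep s) s′ t′
        (trans (up-height p′ p) (cong suc (up-height q′ q)))) x₁≢x₃
    no-straight x₀≢x₂ x₁≢x₃ (up refl p) (down q refl) s′ t′ = contradiction
      (cong (_ ,_) (level-injective (suc-injective
        (trans (sym (up-height refl p)) (up-height refl q))))) x₀≢x₂
    no-straight x₀≢x₂ x₁≢x₃ (down p p′) (up q q′) s′ t′ = contradiction
      (cong (_ ,_) (trans (sym p) (trans (right-cong (trans p′ (sym q))) q′))) x₀≢x₂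

    no-double-rung : ∀ {x y z r r′} → x ≢ z → Step x (inj₁ r) y → Step y (inj₁ r′) z → {A : Set} → A
    no-double-rung x≢z (across {b} refl) (across refl) =
      contradiction (cong (_, _) (sym (not-involutive b))) x≢z

  -- The summation order is the one in which sumOver lists Fin 4.
  cycleSum : (Node → ℕ) → (Link → ℕ) → (x₀ x₁ x₂ x₃ : Node) (e₀ e₁ e₂ e₃ : Link) → ℕ
  cycleSum f g x₀ x₁ x₂ x₃ e₀ e₁ e₂ e₃ =
    f x₀ + (f x₁ + (f x₂ + (f x₃ + 0))) + (g e₀ + (g e₁ + (g e₂ + (g e₃ + 0))))

  squareSum : (Node → ℕ) → (Link → ℕ) → Square → ℕ
  squareSum f g q = rungSum (left q) + rungSum (right q) + (g (inj₂ (false , q)) + g (inj₂ (true , q)))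
    where
    rungSum : Rung → ℕ
    rungSum r = f (false , r) + f (true , r) + g (inj₁ r)

  private
    -- Here the rail `e₂` is walked from left to right, in `downward` from right to left. The split
    -- on `b` is needed since `squareSum` lists side `false` first.
    upward : ∀ f g b q → cycleSum f g
      (b , left q) (not b , left q) (not b , right q) (b , right q)
      (inj₂ (b , q)) (inj₁ (left q)) (inj₂ (not b , q)) (inj₁ (right q)) ≡ squareSum f g q
    upward f g false q = lemma
      (f (false , left q)) (f (true , left q)) (f (true , right q)) (f (false , right q))
      (g (inj₂ (false , q))) (g (inj₁ (left q))) (g (inj₂ (true , q))) (g (inj₁ (right q)))
      where
      lemma : ∀ a b c d e f g h →
        a + (b + (c + (d + 0))) + (e + (f + (g + (h + 0)))) ≡ a + b + f + (d + c + h) + (e + g)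
      lemma = solve-∀
    upward f g true q = lemma
      (f (true , left q)) (f (false , left q)) (f (false , right q)) (f (true , right q))
      (g (inj₂ (true , q))) (g (inj₁ (left q))) (g (inj₂ (false , q))) (g (inj₁ (right q)))
      where
      lemma : ∀ a b c d e f g h →
        a + (b + (c + (d + 0))) + (e + (f + (g + (h + 0)))) ≡ b + a + f + (c + d + h) + (g + e)
      lemma = solve-∀

    downward : ∀ f g b q → cycleSum f g
      (b , right q) (not b , right q) (not b , left q) (b , left q)
      (inj₂ (b , q)) (inj₁ (right q)) (inj₂ (not b , q)) (inj₁ (left q)) ≡ squareSum f g q
    downward f g false q = lemma
      (f (false , right q)) (f (true , right q)) (f (true , left q)) (f (false , left q))
      (g (inj₂ (false , q))) (g (inj₁ (right q))) (g (inj₂ (true , q))) (g (inj₁ (left q)))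
      where
      lemma : ∀ a b c d e f g h →
        a + (b + (c + (d + 0))) + (e + (f + (g + (h + 0)))) ≡ d + c + h + (a + b + f) + (e + g)
      lemma = solve-∀
    downward f g true q = lemma
      (f (true , right q)) (f (false , right q)) (f (false , left q)) (f (true , left q))
      (g (inj₂ (true , q))) (g (inj₁ (right q))) (g (inj₂ (false , q))) (g (inj₁ (left q)))
      where
      lemma : ∀ a b c d e f g h →
        a + (b + (c + (d + 0))) + (e + (f + (g + (h + 0)))) ≡ c + d + h + (b + a + f) + (g + e)
      lemma = solve-∀

    -- Two rungs in a row go back to the start and two rails in a row are excluded by `no-straight`,
    -- so the links alternate. It remains to see that the two rails belong to one square.
    rung-first : ∀ f g {x₀ x₁ x₂ x₃ e₀ r e₂ e₃} → x₀ ≢ x₂ → x₁ ≢ x₃ →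
      Step x₃ e₀ x₀ → Step x₀ (inj₁ r) x₁ → Step x₁ e₂ x₂ → Step x₂ e₃ x₃ →
      ∃[ q ] cycleSum f g x₀ x₁ x₂ x₃ e₀ (inj₁ r) e₂ e₃ ≡ squareSum f g q
    rung-first f g {e₂ = inj₁ _} ≢₀ ≢₁ s₀ s₁ s₂ s₃ = no-double-rung ≢₀ s₁ s₂
    rung-first f g {e₂ = inj₂ _} {e₃ = inj₂ _} ≢₀ ≢₁ s₀ s₁ s₂ s₃ =
      no-straight ≢₁ (≢₀ ∘ sym) s₂ s₃ s₀ s₁
    rung-first f g {e₀ = inj₁ _} {e₃ = inj₁ _} ≢₀ ≢₁ s₀ s₁ s₂ s₃ =
      no-double-rung (≢₀ ∘ sym) s₃ s₀
    -- Rails both walked up, or both walked down, would close the cycle two levels away from its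
    -- start.
    rung-first f g ≢₀ ≢₁ (up p p′) (across _) (up q q′) (across _) = contradiction
      (trans (up-height p p′) (cong suc (up-height q q′))) (m≢1+n+m _ {1})
    rung-first f g ≢₀ ≢₁ (down p p′) (across _) (down q q′) (across _) = contradiction
      (trans (up-height p′ p) (cong suc (up-height q′ q))) (m≢1+n+m _ {1})
    -- In opposite directions the two rails share their left rung, hence their square.
    rung-first f g ≢₀ ≢₁ (down refl refl) (across refl) (up q q′) (across _)
      with refl ← left-injective q | refl ← q′ = _ , upward f g _ _
    rung-first f g ≢₀ ≢₁ (up refl refl) (across refl) (down q q′) (across _)
      with refl ← left-injective q′ | refl ← q = _ , downward f g _ _

  -- One of `e₁` and `e₂` is a rung. If it is `e₂`, the cycle is read from its next vertex on, which
  -- only permutes the summands.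
  cycleSum-square : ∀ f g {x₀ x₁ x₂ x₃ e₀ e₁ e₂ e₃} → x₀ ≢ x₂ → x₁ ≢ x₃ →
    Step x₃ e₀ x₀ → Step x₀ e₁ x₁ → Step x₁ e₂ x₂ → Step x₂ e₃ x₃ →
    ∃[ q ] cycleSum f g x₀ x₁ x₂ x₃ e₀ e₁ e₂ e₃ ≡ squareSum f g q
  cycleSum-square f g {e₁ = inj₁ _} ≢₀ ≢₁ s₀ s₁ s₂ s₃ = rung-first f g ≢₀ ≢₁ s₀ s₁ s₂ s₃
  cycleSum-square f g {e₁ = inj₂ _} {e₂ = inj₂ _} ≢₀ ≢₁ s₀ s₁ s₂ s₃ = no-straight ≢₀ ≢₁ s₁ s₂ s₃ s₀
  cycleSum-square f g {x₀} {x₁} {x₂} {x₃} {e₀} {e₁ = e₁@(inj₂ _)} {e₂ = e₂@(inj₁ _)} {e₃}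
    ≢₀ ≢₁ s₀ s₁ s₂ s₃
    with q , eq ← rung-first f g ≢₁ (≢₀ ∘ sym) s₁ s₂ s₃ s₀ =
    q , trans (rotate (f x₀) (f x₁) (f x₂) (f x₃) (g e₀) (g e₁) (g e₂) (g e₃)) eq
    where
    rotate : ∀ a₀ a₁ a₂ a₃ b₀ b₁ b₂ b₃ →
      a₀ + (a₁ + (a₂ + (a₃ + 0))) + (b₀ + (b₁ + (b₂ + (b₃ + 0)))) ≡
      a₁ + (a₂ + (a₃ + (a₀ + 0))) + (b₁ + (b₂ + (b₃ + (b₀ + 0))))
    rotate = solve-∀

  weight-square : ∀ (ℓ : Labeling G) S → toGraph S ≅ C 4 → ∃[ q ] weight {G} ℓ S ≡
    squareSum (λ x → label {G} ℓ (inj₁ (from vertices x))) (λ e → label {G} ℓ (inj₂ (from edges e))) q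
  weight-square ℓ S iso = proj₁ cycle , trans weight≡ (proj₂ cycle)
    where
    f : Node → ℕ
    f x = label {G} ℓ (inj₁ (from vertices x))

    g : Link → ℕ
    g e = label {G} ℓ (inj₂ (from edges e))

    node : Fin 4 → Node
    node i = to vertices (proj₁ (from (bij iso) i))

    link : Fin 4 → Link
    link i = to edges (proj₁ (from (≅-edges iso) i))

    -- Edge `i` of `C 4` leads from `prev i` to `i`, so link 0 closes the cycle from node 3 to node
    -- 0.
    step : ∀ i → Step (node (prev i)) (link i) (node i)
    step i = Joins⇒Step (Joins-toGraph⁻ S (≅-edges-joins iso i))

    distinct : ∀ i j → i ≢ j → node i ≢ node j
    distinct i j i≢j eq = i≢j (to-injective (↔-sym (bij iso)) (subset-≡ (to-injective vertices eq)))

    cycle : ∃[ q ] cycleSum f g (node 0F) (node 1F) (node 2F) (node 3F)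
                                (link 0F) (link 1F) (link 2F) (link 3F) ≡ squareSum f g q
    cycle = cycleSum-square f g (distinct 0F 2F λ ()) (distinct 1F 3F λ ())
                                (step 0F) (step 1F) (step 2F) (step 3F)

    weight≡ : weight {G} ℓ S ≡ cycleSum f g (node 0F) (node 1F) (node 2F) (node 3F)
                                           (link 0F) (link 1F) (link 2F) (link 3F)
    weight≡ = cong₂ _+_
      (trans (sumOver-↔ (V-finite (toGraph S)) (Fin-finite 4) (bij iso)
          (λ x → label {G} ℓ (inj₁ (proj₁ x))))
        (sum-cong-≗ +-0-commutativeMonoid
          (λ i → cong (label {G} ℓ ∘ inj₁) (sym (strictlyInverseʳ vertices (proj₁ (from (bij iso) i)))))))
      (trans (sumOver-↔ (E-finite (toGraph S)) (Fin-finite 4) (≅-edges iso)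
          (λ e → label {G} ℓ (inj₂ (proj₁ e))))
        (sum-cong-≗ +-0-commutativeMonoid
          (λ i → cong (label {G} ℓ ∘ inj₂) (sym (strictlyInverseʳ edges (proj₁ (from (≅-edges iso) i)))))))

  -- The covering by squares

  square : Square → Embedding (C 4) G
  square q = record
    { onV       = from vertices ∘ corner
    ; onE       = from edges ∘ side
    ; injective = λ eq → corner-injective _ _ (to-injective (↔-sym vertices) eq)
    ; joins     = λ
      -- Side `i` runs from corner `prev i` to corner `i`; sides 0 and 3 run against the order in
      -- which `ends` lists their corners.
      { 0F → inj₂ (ends-rail false q)
      ; 1F → inj₁ (ends-rung (left q))
      ; 2F → inj₁ (ends-rail true q)
      ; 3F → inj₂ (ends-rung (right q)) }
    }
    where
    corner : Fin 4 → Node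
    corner 0F = false , left q
    corner 1F = true , left q
    corner 2F = true , right q
    corner 3F = false , right q

    side : Fin 4 → Link
    side 0F = inj₂ (false , q)
    side 1F = inj₁ (left q)
    side 2F = inj₂ (true , q)
    side 3F = inj₁ (right q)

    corner-injective : ∀ x y → corner x ≡ corner y → x ≡ y
    corner-injective 0F 0F eq = refl
    corner-injective 0F 1F ()
    corner-injective 0F 2F ()
    corner-injective 0F 3F eq = contradiction (cong proj₂ eq) (left≢right q)
    corner-injective 1F 0F ()
    corner-injective 1F 1F eq = refl
    corner-injective 1F 2F eq = contradiction (cong proj₂ eq) (left≢right q)
    corner-injective 1F 3F ()
    corner-injective 2F 0F ()
    corner-injective 2F 1F eq = contradiction (cong proj₂ (sym eq)) (left≢right q)
    corner-injective 2F 2F eq = refl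
    corner-injective 2F 3F ()
    corner-injective 3F 0F eq = contradiction (cong proj₂ (sym eq)) (left≢right q)
    corner-injective 3F 1F ()
    corner-injective 3F 2F ()
    corner-injective 3F 3F eq = refl

  covering : HasCovering (C 4) G
  covering e = subst (λ e → Σ[ S ∈ Subgraph G ] (T (inE S e) × toGraph S ≅ C 4))
                     (strictlyInverseʳ edges e) (cover (to edges e))
    where
    inSquare : ∀ q i → Σ[ S ∈ Subgraph G ] (T (inE S (Embedding.onE (square q) i)) × toGraph S ≅ C 4)
    inSquare q i = imageSubgraph (square q) , onE∈image (square q) i , image≅ (square q)

    cover : ∀ l → Σ[ S ∈ Subgraph G ] (T (inE S (from edges l)) × toGraph S ≅ C 4)
    cover (inj₁ r) with covered r
    ... | q , inj₁ refl = inSquare q 1F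
    ... | q , inj₂ refl = inSquare q 3F
    cover (inj₂ (false , q)) = inSquare q 0F
    cover (inj₂ (true , q))  = inSquare q 2F

  -- The labeling and its magic constant

  private
    zigzagRungs : Rung ↔ Fin (⌈ #rungs /2⌉ + ⌊ #rungs /2⌋)
    zigzagRungs = ↔-trans rungs zigzag

    reverseRungs : Rung ↔ Fin #rungs
    reverseRungs = ↔-trans rungs reverse

    reverseSquares : Square ↔ Fin #squares
    reverseSquares = ↔-trans squares reverse

    sides : (Rung ⊎ Rung) ↔ Fin (#rungs + (⌈ #rungs /2⌉ + ⌊ #rungs /2⌋))
    sides = append reverseRungs zigzagRungs

    rails : (Square ⊎ Square) ↔ Fin (#squares + #squares)
    rails = append squares reverseSquares

    numberVertices : V G ↔ Fin (#rungs + (⌈ #rungs /2⌉ + ⌊ #rungs /2⌋))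
    numberVertices = ↔-trans vertices (↔-trans Bool×↔⊎ sides)

    numberEdges : E G ↔ Fin (⌈ #rungs /2⌉ + ⌊ #rungs /2⌋ + (#squares + #squares))
    numberEdges = ↔-trans edges (append zigzagRungs (↔-trans Bool×↔⊎ rails))

    ℓ : Labeling G
    ℓ = verticesThenEdges G numberVertices numberEdges

    label-node : ∀ x → label {G} ℓ (inj₁ (from vertices x)) ≡ suc (toℕ (to sides (to Bool×↔⊎ x)))
    label-node x = trans (label-vertex G numberVertices numberEdges (from vertices x))
      (cong (suc ∘ toℕ ∘ to sides ∘ to Bool×↔⊎) (strictlyInverseˡ vertices x))

    label-link : ∀ e → label {G} ℓ (inj₂ (from edges e)) ≡
                 suc (∣V∣ G + toℕ (to (append zigzagRungs (↔-trans Bool×↔⊎ rails)) e))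
    label-link e = trans (label-edge G numberVertices numberEdges (from edges e))
      (cong (λ e → suc (∣V∣ G + toℕ (to (append zigzagRungs (↔-trans Bool×↔⊎ rails)) e)))
        (strictlyInverseˡ edges e))

    label-node₁ : ∀ r → label {G} ℓ (inj₁ (from vertices (false , r))) ≡
                  suc (toℕ (opposite (to rungs r)))
    label-node₁ r = trans (label-node (false , r)) (cong suc (toℕ-append₁ reverseRungs zigzagRungs r))

    label-node₂ : ∀ r → label {G} ℓ (inj₁ (from vertices (true , r))) ≡
                  suc (#rungs + toℕ (to zigzagRungs r))
    label-node₂ r = trans (label-node (true , r)) (cong suc (toℕ-append₂ reverseRungs zigzagRungs r))

    label-rung : ∀ r → label {G} ℓ (inj₂ (from edges (inj₁ r))) ≡
                 suc (∣V∣ G + toℕ (to zigzagRungs r))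
    label-rung r = trans (label-link (inj₁ r))
      (cong (λ p → suc (∣V∣ G + p)) (toℕ-append₁ zigzagRungs (↔-trans Bool×↔⊎ rails) r))

    label-rail₁ : ∀ q → label {G} ℓ (inj₂ (from edges (inj₂ (false , q)))) ≡
                  suc (∣V∣ G + (⌈ #rungs /2⌉ + ⌊ #rungs /2⌋ + toℕ (to squares q)))
    label-rail₁ q = trans (label-link (inj₂ (false , q))) (cong (λ p → suc (∣V∣ G + p))
      (trans (toℕ-append₂ zigzagRungs (↔-trans Bool×↔⊎ rails) (false , q))
        (cong (⌈ #rungs /2⌉ + ⌊ #rungs /2⌋ +_) (toℕ-append₁ squares reverseSquares q))))

    label-rail₂ : ∀ q → label {G} ℓ (inj₂ (from edges (inj₂ (true , q)))) ≡
                  suc (∣V∣ G + (⌈ #rungs /2⌉ + ⌊ #rungs /2⌋ + (#squares + toℕ (opposite (to squares q)))))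
    label-rail₂ q = trans (label-link (inj₂ (true , q))) (cong (λ p → suc (∣V∣ G + p))
      (trans (toℕ-append₂ zigzagRungs (↔-trans Bool×↔⊎ rails) (true , q))
        (cong (⌈ #rungs /2⌉ + ⌊ #rungs /2⌋ +_) (toℕ-append₂ squares reverseSquares q))))

    -- The arithmetic of a square, freed from its graph. `N`, `M` and `W` count rungs, squares and
    -- vertices, `K` is the size of the range of the zigzag, `h` is `⌈ N /2⌉` and `l` the level of
    -- the left rung. The `z` are zigzag values, `oₗ`, `oᵣ` and `o` reversed numbers, and `q` is the
    -- number of the square. The labels are `a₀`, `a₁`, `b` on the left rung, `c₀`, `c₁`, `d` on the
    -- right rung, and `e₀`, `e₁` on the rails.
    labels-sum : ∀ {N M W K h l oₗ oᵣ zₗ zᵣ q o a₀ a₁ b c₀ c₁ d e₀ e₁} →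
      a₀ ≡ suc oₗ → a₁ ≡ suc (N + zₗ) → b ≡ suc (W + zₗ) →
      c₀ ≡ suc oᵣ → c₁ ≡ suc (N + zᵣ) → d ≡ suc (W + zᵣ) →
      e₀ ≡ suc (W + (K + q)) → e₁ ≡ suc (W + (K + (M + o))) →
      zₗ + zᵣ ≡ h + l → oₗ + suc l ≡ N → oᵣ + suc (suc l) ≡ N → o + suc q ≡ M →
      a₀ + a₁ + b + (c₀ + c₁ + d) + (e₀ + e₁) ≡
      N + N + (h + h) + (M + (4 + (N + N) + 4 * W + (K + K) + M))
    labels-sum {N} {M} {W} {K} {h} {l} {oₗ} {oᵣ} {zₗ} {zᵣ} {q} {o}
      refl refl refl refl refl refl refl refl z≡ oₗ≡ oᵣ≡ o≡ = begin
      suc oₗ + suc (N + zₗ) + suc (W + zₗ) + (suc oᵣ + suc (N + zᵣ) + suc (W + zᵣ))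
        + (suc (W + (K + q)) + suc (W + (K + (M + o))))
        ≡⟨ regroup N M W K oₗ oᵣ zₗ zᵣ q o ⟩
      oₗ + oᵣ + (zₗ + zᵣ + (zₗ + zᵣ)) + (o + suc q + (7 + (N + N) + 4 * W + (K + K) + M))
        ≡⟨ cong (λ z → oₗ + oᵣ + (z + z) + (o + suc q + (7 + (N + N) + 4 * W + (K + K) + M))) z≡ ⟩
      oₗ + oᵣ + (h + l + (h + l)) + (o + suc q + (7 + (N + N) + 4 * W + (K + K) + M))
        -- The two `l` from the zigzag, with three of the seven units, complete `oₗ` and `oᵣ` to `N`
        -- each: this is where the dependence on the level cancels. The eighth unit of the eight
        -- labels is already in `suc q`.
        ≡⟨ complete N M W K oₗ oᵣ h l q o ⟩
      oₗ + suc l + (oᵣ + suc (suc l)) + (h + h) + (o + suc q + (4 + (N + N) + 4 * W + (K + K) + M))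
        ≡⟨ cong₂ (λ a b → a + (h + h) + (b + (4 + (N + N) + 4 * W + (K + K) + M))) (cong₂ _+_ oₗ≡ oᵣ≡) o≡ ⟩
      N + N + (h + h) + (M + (4 + (N + N) + 4 * W + (K + K) + M)) ∎
      where
      open ≡-Reasoning
      regroup : ∀ N M W K oₗ oᵣ zₗ zᵣ q o →
        suc oₗ + suc (N + zₗ) + suc (W + zₗ) + (suc oᵣ + suc (N + zᵣ) + suc (W + zᵣ))
          + (suc (W + (K + q)) + suc (W + (K + (M + o))))
        ≡ oₗ + oᵣ + (zₗ + zᵣ + (zₗ + zᵣ)) + (o + suc q + (7 + (N + N) + 4 * W + (K + K) + M))
      regroup = solve-∀
      complete : ∀ N M W K oₗ oᵣ h l q o →
        oₗ + oᵣ + (h + l + (h + l)) + (o + suc q + (7 + (N + N) + 4 * W + (K + K) + M))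
        ≡ oₗ + suc l + (oᵣ + suc (suc l)) + (h + h) + (o + suc q + (4 + (N + N) + 4 * W + (K + K) + M))
      complete = solve-∀

    magicSum : ℕ
    magicSum = #rungs + #rungs + (⌈ #rungs /2⌉ + ⌈ #rungs /2⌉) + (#squares +
      (4 + (#rungs + #rungs) + 4 * ∣V∣ G
        + (⌈ #rungs /2⌉ + ⌊ #rungs /2⌋ + (⌈ #rungs /2⌉ + ⌊ #rungs /2⌋)) + #squares))

    squareSum≡magicSum : ∀ q → squareSum (λ x → label {G} ℓ (inj₁ (from vertices x)))
                                         (λ e → label {G} ℓ (inj₂ (from edges e))) q ≡ magicSum
    squareSum≡magicSum q = labels-sum
      (label-node₁ (left q)) (label-node₂ (left q)) (label-rung (left q))
      (label-node₁ (right q)) (label-node₂ (right q)) (label-rung (right q))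
      (label-rail₁ q) (label-rail₂ q)
      (zigzag-suc (to rungs (left q)) (to rungs (right q)) (consecutive q))
      (toℕ-opposite (to rungs (left q)))
      (subst (λ p → toℕ (opposite (to rungs (right q))) + suc p ≡ #rungs) (consecutive q)
        (toℕ-opposite (to rungs (right q))))
      (toℕ-opposite (to squares q))

    magic : IsMagic (C 4) G ℓ
    magic = magicSum , λ S iso →
      trans (proj₂ (weight-square ℓ S iso)) (squareSum≡magicSum (proj₁ (weight-square ℓ S iso)))

  supermagic : Supermagic (C 4) G
  supermagic = covering , ℓ , magic , verticesFirst G numberVertices numberEdges

theorem10 : ∀ (s k n : ℕ) → 1 ≤ s → 1 ≤ k → 2 ≤ n → Supermagic (C 4) ((s · L (suc n)) ∪ (k · L n))
theorem10 s k n _ _ 2≤n = supermagic {G = (s · L (suc n)) ∪ (k · L n)}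
  (union {s · L (suc n)} {k · L n}
    (copies {L (suc n)} s (ladder (m≤n⇒m≤1+n 2≤n)))
    (copies {L n} k (ladder 2≤n)))
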